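{- Let $x_i$ and $y_i$ ($i=1,2,\dots$) be indeterminates, and let $n$ be a positive integer. Then $$\operatorname{Pf}_\lambda\bigl(x_iy_j\bigr)_{1\le i<j\le 2n}=\prod_{i=1}^n x_{2i-1}y_{2i}.$$
   Context: $\lambda$ is an indeterminate. For an array $(A_{ij})_{1\le i<j\le 2n}$ (the strictly upper triangular part of a skew-symmetric matrix of size $2n$), the $\lambda$-Pfaffian is $$\operatorname{Pf}_\lambda(A_{ij})_{1\le i<j\le 2n}=\sum_{m\in\mathcal M([2n])}(-1)^{\mathrm{cross}(m)}\,\lambda^{\mathrm{cross}(m)+\mathrm{nest}(m)}\prod_{i=1}^n A_{m_{2i-1}m_{2i}}.$$ Here $\mathcal M([2n])$ is the set of perfect matchings of $[2n]=\{1,\dots,2n\}$, written $m=((m_1,m_2),\dots,(m_{2n-1},m_{2n}))$ with $m_{2i-1}<m_{2i}$ for all $i$ and $m_1<m_3<\cdots<m_{2n-1}$. $\mathrm{cross}(m)$ is the number of (unordered) pairs of pairs $(a,b),(c,d)$ in $m$ with $a<c<b<d$; $\mathrm{nest}(m)$ is the number of pairs of pairs $(a,b),(c,d)$ in $m$ with $a<c<d<b$. -}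

module Defs where

open import Algebra.Bundles using (CommutativeRing; Semiring)
import Algebra.Definitions.RawSemiring as RawSemiringDefinitions
open import Data.Fin using (Fin; toℕ; _<_)
open import Data.Fin.Properties using (_≟_; _<?_; all?; any?)
open import Data.List as List using (List; []; _∷_; allFin; cartesianProduct; cartesianProductWith; filter; length)
open import Data.Nat as ℕ using (ℕ; zero; suc)
open import Data.Product using (_×_; _,_; ∃; proj₁; proj₂)
open import Data.Sum using (_⊎_)
open import Data.Vec as Vec using (Vec; []; _∷_; lookup)
open import Relation.Binary.PropositionalEquality using (_≡_)
open import Relation.Nullary using (Dec)
open import Relation.Nullary.Decidable using (map′; _×-dec_; _⊎-dec_; _→-dec_)

-- The set [ N ] = {1, …, N} is represented by Fin N; the index i : Fin N
-- stands for the integer ⟦ i ⟧.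

⟦_⟧ : ∀ {N} → Fin N → ℕ
⟦ i ⟧ = suc (toℕ i)

Pair : ℕ → Set
Pair N = Fin N × Fin N

infix 4 _∈ₚ_ _∈ₚ?_

_∈ₚ_ : ∀ {N} → Fin N → Pair N → Set
k ∈ₚ (a , b) = k ≡ a ⊎ k ≡ b

_∈ₚ?_ : ∀ {N} (k : Fin N) (p : Pair N) → Dec (k ∈ₚ p)
k ∈ₚ? (a , b) = k ≟ a ⊎-dec k ≟ b

-- A perfect matching of [2n] in its unique standard form
-- ((m₁ , m₂) , … , (m₂ₙ₋₁ , m₂ₙ)).

record IsPerfectMatching {n} (m : Vec (Pair (2 ℕ.* n)) n) : Set where
  field
    covers   : ∀ k → ∃ λ i → k ∈ₚ lookup m i
    disjoint : ∀ k i j → k ∈ₚ lookup m i → k ∈ₚ lookup m j → i ≡ j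
    oriented : ∀ i → proj₁ (lookup m i) < proj₂ (lookup m i)
    sorted   : ∀ i j → i < j → proj₁ (lookup m i) < proj₁ (lookup m j)

isPerfectMatching? : ∀ {n} (m : Vec (Pair (2 ℕ.* n)) n) → Dec (IsPerfectMatching m)
isPerfectMatching? m =
  map′ (λ (c , d , o , s) → record { covers = c ; disjoint = d ; oriented = o ; sorted = s })
       (λ pm → let open IsPerfectMatching pm in covers , disjoint , oriented , sorted)
       (     all? (λ k → any? λ i → k ∈ₚ? lookup m i)
       ×-dec all? (λ k → all? λ i → all? λ j →
               k ∈ₚ? lookup m i →-dec (k ∈ₚ? lookup m j →-dec i ≟ j))
       ×-dec all? (λ i → proj₁ (lookup m i) <? proj₂ (lookup m i))
       ×-dec all? (λ i → all? λ j →
               i <? j →-dec proj₁ (lookup m i) <? proj₁ (lookup m j)))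

-- All vectors with entries in xs; free of repetitions if xs is.

vectors : ∀ {a} {A : Set a} → List A → (n : ℕ) → List (Vec A n)
vectors xs zero    = [] ∷ []
vectors xs (suc n) = cartesianProductWith _∷_ xs (vectors xs n)

perfectMatchings : (n : ℕ) → List (Vec (Pair (2 ℕ.* n)) n)
perfectMatchings n =
  filter isPerfectMatching?
         (vectors (cartesianProduct (allFin (2 ℕ.* n)) (allFin (2 ℕ.* n))) n)

Crosses Nests : ∀ {N} → Pair N × Pair N → Set
Crosses ((a , b) , (c , d)) = a < c × c < b × b < d
Nests   ((a , b) , (c , d)) = a < c × c < d × d < b

crosses? : ∀ {N} (pq : Pair N × Pair N) → Dec (Crosses pq)
crosses? ((a , b) , (c , d)) = a <? c ×-dec c <? b ×-dec b <? d

nests? : ∀ {N} (pq : Pair N × Pair N) → Dec (Nests pq)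
nests? ((a , b) , (c , d)) = a <? c ×-dec c <? d ×-dec d <? b

-- Both counts range over ordered pairs of pairs, but the condition a < c
-- holds for at most one of the two orders, so each unordered pair of pairs
-- contributes at most once.

cross nest : ∀ {N n} → Vec (Pair N) n → ℕ
cross m = length (filter crosses? (cartesianProduct (Vec.toList m) (Vec.toList m)))
nest  m = length (filter nests?   (cartesianProduct (Vec.toList m) (Vec.toList m)))

module _ {c ℓ} (R : CommutativeRing c ℓ) where

  open CommutativeRing R
  open RawSemiringDefinitions (Semiring.rawSemiring semiring) using (product; _^_)

  ∏ : (n : ℕ) → (Fin n → Carrier) → Carrier
  ∏ n f = product f

  ∑ : ∀ {a} {A : Set a} → List A → (A → Carrier) → Carrier
  ∑ xs f = List.foldr _+_ 0# (List.map f xs)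

  -- Only the entries A i j with i < j are used.

  Pf : (n : ℕ) → Carrier → (Fin (2 ℕ.* n) → Fin (2 ℕ.* n) → Carrier) → Carrier
  Pf n ƛ A = ∑ (perfectMatchings n) λ m →
    (- 1#) ^ cross m * ƛ ^ (cross m ℕ.+ nest m)
      * ∏ n (λ i → A (proj₁ (lookup m i)) (proj₂ (lookup m i)))

{-# OPTIONS --safe #-}
module Submission where

open import Defs
open import Algebra.Bundles using (CommutativeRing; Semiring)
import Algebra.Definitions.RawSemiring as RawSemiringDefinitions
open import Data.Nat as ℕ using (ℕ; zero; suc; NonZero)
import Data.Nat.Properties as ℕ
open import Data.Nat.ListAction using (sum)
open import Data.Nat.ListAction.Properties using (sum-++; sum-↭)
open import Data.Nat.Tactic.RingSolver using (solve-∀)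
open import Data.Bool using (if_then_else_)
open import Data.Empty using (⊥; ⊥-elim)
open import Data.Fin using (Fin; zero; suc; toℕ; _<_; cast; combine)
import Data.Fin.Properties as Fin
open import Data.Fin.Permutation as Perm using (Permutation′; _⟨$⟩ʳ_; _⟨$⟩ˡ_; inverseʳ; inverseˡ; lift₀)
open import Data.List as List using (List; []; _∷_; _++_; map; filter; length; cartesianProduct; allFin)
open import Data.List.Properties using (map-cong; map-cong-local; map-++; map-∘; filter-none)
open import Data.List.Membership.Propositional using (_∈_)
open import Data.List.Membership.Propositional.Properties
  using (∈-map⁺; ∈-map⁻; ∈-filter⁺; ∈-filter⁻; ∈-cartesianProduct⁺; ∈-cartesianProduct⁻; ∈-cartesianProductWith⁺; ∈-allFin)
open import Data.List.Membership.Propositional.Properties.WithK using (unique∧set⇒bag)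
open import Data.List.Relation.Binary.BagAndSetEquality using (∼bag⇒↭)
open import Data.List.Relation.Binary.Permutation.Propositional as ↭ using (_↭_; ↭⇒↭ₛ′; ↭-refl; ↭-sym; ↭-trans)
open import Data.List.Relation.Binary.Permutation.Propositional.Properties using (All-resp-↭; ∈-resp-↭; map⁺)
open import Data.List.Relation.Binary.Permutation.Setoid.Properties using (foldr-commMonoid)
open import Data.List.Relation.Unary.All as All using (All; []; _∷_)
import Data.List.Relation.Unary.All.Properties as All
open import Data.List.Relation.Unary.AllPairs using ([]; _∷_)
open import Data.List.Relation.Unary.Any using (here; there)
open import Data.List.Relation.Unary.Unique.Propositional using (Unique)
import Data.List.Relation.Unary.Unique.Propositional.Properties as Unique
open import Data.Product using (_×_; _,_; ∃; ∃₂; proj₁; proj₂)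
open import Data.Sum using (_⊎_; inj₁; inj₂; [_,_]′)
open import Data.Vec as Vec using (Vec; []; _∷_; lookup; toList; tabulate)
open import Data.Vec.Properties using (lookup∘tabulate; ∷-injective)
import Data.Vec.Membership.Propositional.Properties as Vec
import Data.Vec.Relation.Unary.All.Properties as VecAll
open import Data.Vec.Relation.Unary.Any.Properties using (tabulate⁻)
open import Function using (_∘_; mk⇔)
open import Relation.Binary.Definitions using (tri<; tri≈; tri>)
open import Relation.Binary.PropositionalEquality
  using (_≡_; _≢_; refl; sym; trans; cong; cong₂; subst; subst₂; module ≡-Reasoning)
open import Relation.Nullary using (Dec; yes; no; ¬_; does; contradiction)
open import Relation.Nullary.Decidable using (¬?; dec-true; dec-false)
open import Relation.Unary using (Decidable)

-- The sum is evaluated by a sign-reversing involution.  At the first two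
-- consecutive arcs (a , b), (c , d) with c < b, exchange the right endpoints
-- b and d.  The left and the right endpoints of the matching stay the same as
-- sets, hence so does ∏ xᵢ yⱼ.  No arc starts between a and c, so the pairs
-- formed with any third arc contribute the same numbers of crossings and
-- nestings before and after, while the two arcs themselves turn from crossing
-- to nesting or back: cross + nest is preserved and cross changes by 1.  The
-- only matching left is the one with a₁ < b₁ < a₂ < b₂ < ⋯, that is
-- (1 , 2), (3 , 4), ….

-- Covering is omitted so that the property passes to tails.

record IsMatching {N k} (m : Vec (Pair N) k) : Set where
  field
    disjoint : ∀ v i j → v ∈ₚ lookup m i → v ∈ₚ lookup m j → i ≡ j
    oriented : ∀ i → proj₁ (lookup m i) < proj₂ (lookup m i)
    sorted   : ∀ i j → i < j → proj₁ (lookup m i) < proj₁ (lookup m j)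

open IsMatching

private variable
  N k : ℕ
  m m′ : Vec (Pair N) k

perfect⇒matching : ∀ {n} {m : Vec (Pair (2 ℕ.* n)) n} → IsPerfectMatching m → IsMatching m
perfect⇒matching pm = record { IsPerfectMatching pm }

tail : ∀ {p} → IsMatching (p ∷ m) → IsMatching m
tail im .disjoint v i j v∈i v∈j = Fin.suc-injective (im .disjoint v (suc i) (suc j) v∈i v∈j)
tail im .oriented i = im .oriented (suc i)
tail im .sorted i j i<j = im .sorted (suc i) (suc j) (ℕ.s≤s i<j)

-- The exchange at the first overlap, and the matchings that have none.

flip-∷ : Pair N → Vec (Pair N) k → Vec (Pair N) (suc k)
flip-∷ p [] = p ∷ []
flip-∷ p (q ∷ m) with proj₁ q Fin.<? proj₂ p
... | yes _ = (proj₁ p , proj₂ q) ∷ (proj₁ q , proj₂ p) ∷ m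
... | no  _ = p ∷ flip-∷ q m

flip : Vec (Pair N) k → Vec (Pair N) k
flip []      = []
flip (p ∷ m) = flip-∷ p m

-- The graph of a proper exchange, so that its properties follow by induction instead of by
-- unfolding `flip`. The inequalities c < b and c < d make `here` symmetric in b and d, and `there`
-- keeps the left endpoint c, so its condition reads the same before and after: the relation is
-- symmetric.
data Flip {N} : ∀ {k} → Vec (Pair N) k → Vec (Pair N) k → Set where
  here  : ∀ {k} {m : Vec (Pair N) k} {a b c d} → c < b → c < d →
          Flip ((a , b) ∷ (c , d) ∷ m) ((a , d) ∷ (c , b) ∷ m)
  there : ∀ {k} {m m′ : Vec (Pair N) k} {a b c d d′} → ¬ c < b →
          Flip ((c , d) ∷ m) ((c , d′) ∷ m′) →
          Flip ((a , b) ∷ (c , d) ∷ m) ((a , b) ∷ (c , d′) ∷ m′)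

Flip-sym : Flip m m′ → Flip m′ m
Flip-sym (here c<b c<d) = here c<d c<b
Flip-sym (there c≮b f)  = there c≮b (Flip-sym f)

flip-disjoint : ∀ {a b c d : Fin N} (m : Vec (Pair N) k) → ¬ c < b →
                flip ((a , b) ∷ (c , d) ∷ m) ≡ (a , b) ∷ flip ((c , d) ∷ m)
flip-disjoint {b = b} {c} m c≮b with c Fin.<? b
... | yes c<b = contradiction c<b c≮b
... | no _    = refl

-- Combined with `Flip-sym`, this gives involutivity of `flip` without evaluating it twice.
Flip⇒flip : Flip m m′ → flip m ≡ m′
Flip⇒flip (here {b = b} {c} c<b _) with c Fin.<? b
... | yes _  = refl
... | no c≮b = contradiction c<b c≮b
Flip⇒flip (there c≮b f) = trans (flip-disjoint _ c≮b) (cong (_ ∷_) (Flip⇒flip f))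

-- The matchings with a₁ < b₁ < a₂ < b₂ < ⋯; `l` is the first place where the next arc may start.
-- Gaps are allowed here, and `Chain-unique` excludes them by counting points.
data Chain {N} : ∀ {k} → ℕ → Vec (Pair N) k → Set where
  []   : ∀ {l} → Chain l []
  cons : ∀ {l k} {m : Vec (Pair N) k} {a b} → l ℕ.≤ toℕ a → a < b →
         Chain (suc (toℕ b)) m → Chain l ((a , b) ∷ m)

Chain⇒flip : ∀ {l} → Chain l m → flip m ≡ m
Chain⇒flip [] = refl
Chain⇒flip (cons _ _ []) = refl
Chain⇒flip (cons _ _ ch@(cons b<c _ _)) =
  trans (flip-disjoint _ (ℕ.<-asym b<c)) (cong (_ ∷_) (Chain⇒flip ch))

-- Each right endpoint b is compared with the next left endpoint c: c < b gives an exchange, c = b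
-- contradicts disjointness, and b < c continues the chain. The left endpoint a is kept in the
-- result because `there` asks for it.
classify-∷ : ∀ {l a b} → l ℕ.≤ toℕ a → IsMatching ((a , b) ∷ m) →
             Chain l ((a , b) ∷ m) ⊎ ∃₂ λ d m′ → Flip ((a , b) ∷ m) ((a , d) ∷ m′)
classify-∷ {m = []} l≤a im = inj₁ (cons l≤a (im .oriented zero) [])
classify-∷ {m = (c , d) ∷ m} {b = b} l≤a im with Fin.<-cmp c b
... | tri< c<b _ _ = inj₂ (_ , _ , here c<b (im .oriented (suc zero)))
... | tri≈ _ refl _ with () ← im .disjoint c zero (suc zero) (inj₂ refl) (inj₁ refl)
... | tri> c≮b _ b<c with classify-∷ b<c (tail im)
...   | inj₁ ch          = inj₁ (cons l≤a (im .oriented zero) ch)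
...   | inj₂ (_ , _ , f) = inj₂ (_ , _ , there c≮b f)

classify : IsMatching m → Chain 0 m ⊎ ∃ (Flip m)
classify {m = []}    im = inj₁ []
classify {m = _ ∷ _} im with classify-∷ ℕ.z≤n im
... | inj₁ ch          = inj₁ ch
... | inj₂ (_ , _ , f) = inj₂ (_ , f)

+-2*suc : ∀ l k → l ℕ.+ 2 ℕ.* suc k ≡ suc (suc l) ℕ.+ 2 ℕ.* k
+-2*suc = solve-∀

-- Each arc uses up at least two places: from l ≤ a < b the next bound, b + 1, is at least l + 2.
Chain-length : ∀ {l} {m : Vec (Pair N) k} → l ℕ.≤ N → Chain l m → l ℕ.+ 2 ℕ.* k ℕ.≤ N
Chain-length {l = l} l≤N [] = subst (ℕ._≤ _) (sym (ℕ.+-identityʳ l)) l≤N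
Chain-length {N} {suc k} {l} l≤N (cons {b = b} l≤a a<b ch) = begin
  l ℕ.+ 2 ℕ.* suc k       ≡⟨ +-2*suc l k ⟩
  suc (suc l) ℕ.+ 2 ℕ.* k ≤⟨ ℕ.+-monoˡ-≤ (2 ℕ.* k) (ℕ.s≤s (ℕ.≤-<-trans l≤a a<b)) ⟩
  suc (toℕ b) ℕ.+ 2 ℕ.* k ≤⟨ Chain-length (Fin.toℕ<n b) ch ⟩
  N                       ∎
  where
    open ℕ.≤-Reasoning

-- There is no slack: `Chain-length` applied to the tail gives b ≤ l + 1, and l ≤ a < b then forces
-- a = l and b = l + 1.
Chain-unique : ∀ {l} {m m′ : Vec (Pair N) k} → l ℕ.+ 2 ℕ.* k ≡ N → Chain l m → Chain l m′ → m ≡ m′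
Chain-unique eq [] [] = refl
Chain-unique {N} {suc k} {l} eq ch@(cons _ _ ch₁) ch′@(cons _ _ ch₁′)
  with head-values ch | head-values ch′
  where
  head-values : ∀ {m : Vec (Pair N) k} {a b} → Chain l ((a , b) ∷ m) → toℕ a ≡ l × toℕ b ≡ suc l
  head-values {a = a} {b} (cons l≤a a<b ch) = a≡l , ℕ.≤-antisym b≤1+l (subst (λ h → suc h ℕ.≤ toℕ b) a≡l a<b)
    where
    b≤1+l : toℕ b ℕ.≤ suc l
    b≤1+l = ℕ.s≤s⁻¹ (ℕ.+-cancelʳ-≤ (2 ℕ.* k) _ _ (ℕ.≤-trans (Chain-length (Fin.toℕ<n b) ch)
              (ℕ.≤-reflexive (trans (sym eq) (+-2*suc l k)))))
    a≡l : toℕ a ≡ l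
    a≡l = ℕ.≤-antisym (ℕ.s≤s⁻¹ (ℕ.≤-trans a<b b≤1+l)) l≤a
... | a≡l , b≡1+l | a′≡l , b′≡1+l
  with refl ← Fin.toℕ-injective (trans a≡l (sym a′≡l))
     | refl ← Fin.toℕ-injective (trans b≡1+l (sym b′≡1+l)) =
  cong (_ ∷_) (Chain-unique (trans (cong (λ h → suc h ℕ.+ 2 ℕ.* k) b≡1+l) (trans (sym (+-2*suc l k)) eq)) ch₁ ch₁′)

-- What the exchange does to the arcs and their endpoints.

Flip-proj₁ : Flip m m′ → ∀ i → proj₁ (lookup m′ i) ≡ proj₁ (lookup m i)
Flip-proj₁ (here _ _)  zero          = refl
Flip-proj₁ (here _ _)  (suc zero)    = refl
Flip-proj₁ (here _ _)  (suc (suc i)) = refl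
Flip-proj₁ (there _ f) zero          = refl
Flip-proj₁ (there _ f) (suc i)       = Flip-proj₁ f i

-- An adjacent transposition of the indices. Left endpoints stay in place and right endpoints move
-- along it; disjointness and covering are transferred through these two facts alone.
Flip-perm : Flip {N} {k} m m′ → Permutation′ k
Flip-perm (here _ _)  = Perm.swap Perm.id
Flip-perm (there _ f) = lift₀ (Flip-perm f)

Flip-proj₂ : (f : Flip m m′) → ∀ i → proj₂ (lookup m′ i) ≡ proj₂ (lookup m (Flip-perm f ⟨$⟩ʳ i))
Flip-proj₂ (here _ _)  zero          = refl
Flip-proj₂ (here _ _)  (suc zero)    = refl
Flip-proj₂ (here _ _)  (suc (suc i)) = refl
Flip-proj₂ (there _ f) zero          = refl
Flip-proj₂ (there _ f) (suc i)       = Flip-proj₂ f i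

Flip-oriented : Flip m m′ → (∀ i → proj₁ (lookup m i) < proj₂ (lookup m i)) →
                (∀ i j → i < j → proj₁ (lookup m i) < proj₁ (lookup m j)) →
                ∀ i → proj₁ (lookup m′ i) < proj₂ (lookup m′ i)
Flip-oriented (here c<b c<d) or so zero = ℕ.<-trans (so zero (suc zero) (ℕ.s≤s ℕ.z≤n)) c<d
Flip-oriented (here c<b c<d) or so (suc zero) = c<b
Flip-oriented (here c<b c<d) or so (suc (suc i)) = or (suc (suc i))
Flip-oriented (there _ f)    or so zero = or zero
Flip-oriented (there _ f)    or so (suc i) = Flip-oriented f (or ∘ suc) (λ i j → so (suc i) (suc j) ∘ ℕ.s≤s) i

Flip-matching : Flip m m′ → IsMatching m → IsMatching m′
Flip-matching {m = m} {m′} f im = record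
  { disjoint = disjoint′
  ; oriented = Flip-oriented f (im .oriented) (im .sorted)
  ; sorted   = λ i j i<j → subst₂ _<_ (sym (Flip-proj₁ f i)) (sym (Flip-proj₁ f j)) (im .sorted i j i<j)
  }
  where
  τ = Flip-perm f

  -- Such a v would lie on the arcs i and τ j of `m`, which then coincide, so that arc i would have
  -- equal endpoints.
  left-right : ∀ v i j → v ≡ proj₁ (lookup m′ i) → v ≡ proj₂ (lookup m′ j) → ⊥
  left-right v i j v≡aᵢ v≡bⱼ = Fin.<-irrefl (trans (sym a) (trans b (cong (proj₂ ∘ lookup m) (sym i≡τj)))) (im .oriented i)
    where
    a = trans v≡aᵢ (Flip-proj₁ f i)
    b = trans v≡bⱼ (Flip-proj₂ f j)
    i≡τj = im .disjoint v i (τ ⟨$⟩ʳ j) (inj₁ a) (inj₂ b)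

  disjoint′ : ∀ v i j → v ∈ₚ lookup m′ i → v ∈ₚ lookup m′ j → i ≡ j
  disjoint′ v i j (inj₁ p) (inj₁ q) =
    im .disjoint v i j (inj₁ (trans p (Flip-proj₁ f i))) (inj₁ (trans q (Flip-proj₁ f j)))
  disjoint′ v i j (inj₁ p) (inj₂ q) = ⊥-elim (left-right v i j p q)
  disjoint′ v i j (inj₂ p) (inj₁ q) = ⊥-elim (left-right v j i q p)
  disjoint′ v i j (inj₂ p) (inj₂ q) =
    trans (sym (inverseˡ τ)) (trans (cong (τ ⟨$⟩ˡ_) τi≡τj) (inverseˡ τ))
    where
    τi≡τj = im .disjoint v (τ ⟨$⟩ʳ i) (τ ⟨$⟩ʳ j)
              (inj₂ (trans p (Flip-proj₂ f i))) (inj₂ (trans q (Flip-proj₂ f j)))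

Flip-covers : Flip {N} {k} m m′ → (∀ v → ∃ λ i → v ∈ₚ lookup m i) → ∀ v → ∃ λ i → v ∈ₚ lookup m′ i
Flip-covers {m = m} f co v with co v
... | i , inj₁ p = i , inj₁ (trans p (sym (Flip-proj₁ f i)))
... | i , inj₂ p = τ ⟨$⟩ˡ i , inj₂ (trans p (sym (trans (Flip-proj₂ f _) (cong (proj₂ ∘ lookup m) (inverseʳ τ)))))
  where τ = Flip-perm f

Flip-perfect : ∀ {n} {m m′ : Vec (Pair (2 ℕ.* n)) n} → Flip m m′ → IsPerfectMatching m → IsPerfectMatching m′
Flip-perfect f pm = record
  { covers = Flip-covers f (IsPerfectMatching.covers pm)
  ; IsMatching (Flip-matching f (perfect⇒matching pm))
  }

-- The two arcs are brought to the front by a permutation, since counting pairs ignores positions.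
-- The field `outside` is what makes every third arc neutral. The conditions are symmetric in b and
-- d, so `Exchange-sym` can reverse the exchange.
record Exchange {N k} (m m′ : Vec (Pair N) k) : Set where
  field
    {a b c d} : Fin N
    {rest}    : List (Pair N)
    source    : toList m  ↭ (a , b) ∷ (c , d) ∷ rest
    target    : toList m′ ↭ (a , d) ∷ (c , b) ∷ rest
    a<c       : a < c
    c<b       : c < b
    c<d       : c < d
    b≢d       : b ≢ d
    outside   : All (λ r → proj₁ r < a ⊎ c < proj₁ r) rest

Exchange-sym : Exchange m m′ → Exchange m′ m
Exchange-sym e = record
  { source = target ; target = source ; a<c = a<c ; c<b = c<d ; c<d = c<b ; b≢d = b≢d ∘ sym ; outside = outside }
  where open Exchange e

head-minimal : ∀ {p} → IsMatching (p ∷ m) → All (λ r → proj₁ p < proj₁ r) (toList m)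
head-minimal im = VecAll.toList⁺ (VecAll.lookup⁻ (λ i → im .sorted zero (suc i) (ℕ.s≤s ℕ.z≤n)))

-- The two arcs are neighbours in a list sorted by left endpoints: arcs after them start beyond c,
-- arcs before them start before a.
Flip⇒Exchange : IsMatching m → Flip m m′ → Exchange m m′
Flip⇒Exchange im (here c<b c<d) = record
  { source  = ↭-refl
  ; target  = ↭-refl
  ; a<c     = im .sorted zero (suc zero) (ℕ.s≤s ℕ.z≤n)
  ; c<b     = c<b
  ; c<d     = c<d
  ; b≢d     = λ b≡d → Fin.0≢1+n (im .disjoint _ zero (suc zero) (inj₂ refl) (inj₂ b≡d))
  ; outside = All.map inj₂ (head-minimal (tail im))
  }
Flip⇒Exchange {m = p ∷ _} im (there _ f) = record
  { source  = ↭-trans (↭.prep p source) (bring-forward _ _)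
  ; target  = ↭-trans (↭.prep p target) (bring-forward _ _)
  ; a<c = a<c ; c<b = c<b ; c<d = c<d ; b≢d = b≢d
  -- The head arc starts before every arc of the tail, in particular before (a , b), which leads the
  -- permuted tail.
  ; outside = inj₁ (All.head (All-resp-↭ source (head-minimal im))) ∷ outside
  }
  where
  open Exchange (Flip⇒Exchange (tail im) f)
  bring-forward : ∀ q r → p ∷ q ∷ r ∷ rest ↭ q ∷ r ∷ p ∷ rest
  bring-forward q r = ↭.trans (↭.swap p q ↭.refl) (↭.prep q (↭.swap p r ↭.refl))

-- Counting ordered pairs by sums of indicators.

private variable
  A B : Set

ind : {P : Set} → Dec P → ℕ
ind P? = if does P? then 1 else 0

ind-yes : {P : Set} (P? : Dec P) → P → ind P? ≡ 1
ind-yes P? p = cong (if_then 1 else 0) (dec-true P? p)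

ind-no : {P : Set} (P? : Dec P) → ¬ P → ind P? ≡ 0
ind-no P? ¬p = cong (if_then 1 else 0) (dec-false P? ¬p)

ind-cong : {P Q : Set} (P? : Dec P) (Q? : Dec Q) → (P → Q) → (Q → P) → ind P? ≡ ind Q?
ind-cong (yes p) Q? P⇒Q Q⇒P = sym (ind-yes Q? (P⇒Q p))
ind-cong (no ¬p) Q? P⇒Q Q⇒P = sym (ind-no Q? (¬p ∘ Q⇒P))

sumOver : (A → ℕ) → List A → ℕ
sumOver f xs = sum (map f xs)

sumOver-+ : ∀ (f g : A → ℕ) xs → sumOver (λ x → f x ℕ.+ g x) xs ≡ sumOver f xs ℕ.+ sumOver g xs
sumOver-+ f g []       = refl
sumOver-+ f g (x ∷ xs) = trans (cong (f x ℕ.+ g x ℕ.+_) (sumOver-+ f g xs)) (interchange (f x) (g x) _ _)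
  where
  interchange : ∀ a b c d → (a ℕ.+ b) ℕ.+ (c ℕ.+ d) ≡ (a ℕ.+ c) ℕ.+ (b ℕ.+ d)
  interchange = solve-∀

length-filter-ind : {P : A → Set} (P? : Decidable P) (xs : List A) →
                    length (filter P? xs) ≡ sumOver (ind ∘ P?) xs
length-filter-ind P? []       = refl
length-filter-ind P? (x ∷ xs) with P? x
... | yes _ = cong suc (length-filter-ind P? xs)
... | no  _ = length-filter-ind P? xs

sumOver-cartesianProduct : ∀ (g : A × B → ℕ) xs ys →
  sumOver g (cartesianProduct xs ys) ≡ sumOver (λ x → sumOver (λ y → g (x , y)) ys) xs
sumOver-cartesianProduct g []       ys = refl
sumOver-cartesianProduct g (x ∷ xs) ys = begin
  sumOver g (map (x ,_) ys ++ cartesianProduct xs ys)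
    ≡⟨ cong sum (map-++ g (map (x ,_) ys) _) ⟩
  sum (map g (map (x ,_) ys) ++ map g (cartesianProduct xs ys))
    ≡⟨ sum-++ (map g (map (x ,_) ys)) _ ⟩
  sum (map g (map (x ,_) ys)) ℕ.+ sumOver g (cartesianProduct xs ys)
    ≡⟨ cong₂ ℕ._+_ (cong sum (sym (map-∘ ys))) (sumOver-cartesianProduct g xs ys) ⟩
  sumOver (λ y → g (x , y)) ys ℕ.+ sumOver (λ x → sumOver (λ y → g (x , y)) ys) xs
    ∎
  where open ≡-Reasoning

-- Crossings and nestings are both counts over the square of a list, so the bookkeeping is done once
-- for an arbitrary weight.
module PairCount (w : A × A → ℕ) where

  total : List A → ℕ
  total xs = sumOver w (cartesianProduct xs xs)

  total-↭ : ∀ {xs ys} → xs ↭ ys → total xs ≡ total ys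
  total-↭ {xs} {ys} xs↭ys = begin
    total xs                                          ≡⟨ sumOver-cartesianProduct w xs xs ⟩
    sumOver (λ x → sumOver (λ y → w (x , y)) xs) xs   ≡⟨ cong sum (map-cong (λ x → sum-↭ (map⁺ _ xs↭ys)) xs) ⟩
    sumOver (λ x → sumOver (λ y → w (x , y)) ys) xs   ≡⟨ sum-↭ (map⁺ _ xs↭ys) ⟩
    sumOver (λ x → sumOver (λ y → w (x , y)) ys) ys   ≡⟨ sumOver-cartesianProduct w ys ys ⟨
    total ys                                          ∎
    where open ≡-Reasoning

  block : A → A → ℕ
  block p q = w (p , p) ℕ.+ w (p , q) ℕ.+ (w (q , p) ℕ.+ w (q , q))

  outgoing incoming : A → A → A → ℕ
  outgoing p q r = w (p , r) ℕ.+ w (q , r)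
  incoming p q r = w (r , p) ℕ.+ w (r , q)

  remainder : A → A → List A → ℕ
  remainder p q rs = sumOver (outgoing p q) rs ℕ.+ (sumOver (incoming p q) rs ℕ.+ total rs)

  -- The square of the list splits into the 2 × 2 block of `p` and `q`, the two strips joining them
  -- to `rs`, and the square of `rs`.
  total-∷∷ : ∀ p q rs → total (p ∷ q ∷ rs) ≡ block p q ℕ.+ remainder p q rs
  total-∷∷ p q rs = begin
    total (p ∷ q ∷ rs)
      ≡⟨ sumOver-cartesianProduct w (p ∷ q ∷ rs) (p ∷ q ∷ rs) ⟩
    (w (p , p) ℕ.+ (w (p , q) ℕ.+ out p)) ℕ.+ ((w (q , p) ℕ.+ (w (q , q) ℕ.+ out q)) ℕ.+
      sumOver (λ r → w (r , p) ℕ.+ (w (r , q) ℕ.+ out r)) rs)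
      ≡⟨ cong (λ s → (w (p , p) ℕ.+ (w (p , q) ℕ.+ out p)) ℕ.+ ((w (q , p) ℕ.+ (w (q , q) ℕ.+ out q)) ℕ.+ s)) inner ⟩
    (w (p , p) ℕ.+ (w (p , q) ℕ.+ out p)) ℕ.+ ((w (q , p) ℕ.+ (w (q , q) ℕ.+ out q)) ℕ.+
      (sumOver (incoming p q) rs ℕ.+ total rs))
      ≡⟨ regroup (w (p , p)) (w (p , q)) (out p) (w (q , p)) (w (q , q)) (out q) _ ⟩
    block p q ℕ.+ ((out p ℕ.+ out q) ℕ.+ (sumOver (incoming p q) rs ℕ.+ total rs))
      ≡⟨ cong (λ s → block p q ℕ.+ (s ℕ.+ (sumOver (incoming p q) rs ℕ.+ total rs))) (sumOver-+ (λ r → w (p , r)) (λ r → w (q , r)) rs) ⟨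
    block p q ℕ.+ remainder p q rs
      ∎
    where
    open ≡-Reasoning
    out : A → ℕ
    out r = sumOver (λ s → w (r , s)) rs
    inner : sumOver (λ r → w (r , p) ℕ.+ (w (r , q) ℕ.+ out r)) rs ≡ sumOver (incoming p q) rs ℕ.+ total rs
    inner = begin
      sumOver (λ r → w (r , p) ℕ.+ (w (r , q) ℕ.+ out r)) rs
        ≡⟨ cong sum (map-cong (λ r → sym (ℕ.+-assoc (w (r , p)) _ _)) rs) ⟩
      sumOver (λ r → incoming p q r ℕ.+ out r) rs
        ≡⟨ sumOver-+ (incoming p q) out rs ⟩
      sumOver (incoming p q) rs ℕ.+ sumOver out rs
        ≡⟨ cong (sumOver (incoming p q) rs ℕ.+_) (sumOver-cartesianProduct w rs rs) ⟨
      sumOver (incoming p q) rs ℕ.+ total rs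
        ∎
    regroup : ∀ a b c d e f g → (a ℕ.+ (b ℕ.+ c)) ℕ.+ ((d ℕ.+ (e ℕ.+ f)) ℕ.+ g)
                              ≡ (a ℕ.+ b ℕ.+ (d ℕ.+ e)) ℕ.+ ((c ℕ.+ f) ℕ.+ g)
    regroup = solve-∀

  remainder-cong : ∀ {p q p′ q′ rs} →
    All (λ r → outgoing p q r ≡ outgoing p′ q′ r) rs →
    All (λ r → incoming p q r ≡ incoming p′ q′ r) rs →
    remainder p q rs ≡ remainder p′ q′ rs
  remainder-cong {rs = rs} out inc =
    cong₂ (λ s t → s ℕ.+ (t ℕ.+ total rs)) (cong sum (map-cong-local out)) (cong sum (map-cong-local inc))

  -- A third element may contribute differently to each of the two elements, as long as the sum of
  -- both contributions is unchanged. The common `u` is then the `remainder`, and only the block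
  -- varies.
  total-exchange : ∀ {xs ys p q p′ q′ rs} → xs ↭ p ∷ q ∷ rs → ys ↭ p′ ∷ q′ ∷ rs →
    All (λ r → outgoing p q r ≡ outgoing p′ q′ r) rs →
    All (λ r → incoming p q r ≡ incoming p′ q′ r) rs →
    ∃ λ u → total xs ≡ block p q ℕ.+ u × total ys ≡ block p′ q′ ℕ.+ u
  total-exchange {p = p} {q} {p′} {q′} {rs} xs↭ ys↭ out inc =
    remainder p q rs ,
    trans (total-↭ xs↭) (total-∷∷ p q rs) ,
    trans (total-↭ ys↭) (trans (total-∷∷ p′ q′ rs) (cong (block p′ q′ ℕ.+_) (sym (remainder-cong out inc))))

-- Crossings and nestings under the exchange.

ind-+-straight : {P P′ Q Q′ : Set} (P? : Dec P) (P′? : Dec P′) (Q? : Dec Q) (Q′? : Dec Q′) →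
  (P → P′) × (P′ → P) → (Q → Q′) × (Q′ → Q) → ind P? ℕ.+ ind Q? ≡ ind P′? ℕ.+ ind Q′?
ind-+-straight P? P′? Q? Q′? (f , f⁻¹) (g , g⁻¹) = cong₂ ℕ._+_ (ind-cong P? P′? f f⁻¹) (ind-cong Q? Q′? g g⁻¹)

-- For a relation to a third arc that follows the right endpoint, passing from (a , b) to (c , b)
-- and from (c , d) to (a , d). In `ind-+-straight` it follows the left endpoint.
ind-+-crossed : {P P′ Q Q′ : Set} (P? : Dec P) (P′? : Dec P′) (Q? : Dec Q) (Q′? : Dec Q′) →
  (P → Q′) × (Q′ → P) → (Q → P′) × (P′ → Q) → ind P? ℕ.+ ind Q? ≡ ind P′? ℕ.+ ind Q′?
ind-+-crossed P? P′? Q? Q′? f g =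
  trans (ind-+-straight P? Q′? Q? P′? f g) (ℕ.+-comm (ind Q′?) (ind P′?))

-- Of the four ordered pairs in the block, only the one with increasing left endpoints can satisfy
-- P.
irrefl-block : {P : Pair N × Pair N → Set} (P? : Decidable P) (a b c d : Fin N) →
  (∀ {p q} → P (p , q) → proj₁ p < proj₁ q) → a < c →
  PairCount.block (ind ∘ P?) (a , b) (c , d) ≡ ind (P? ((a , b) , (c , d)))
irrefl-block P? a b c d P⇒< a<c
  rewrite ind-no (P? ((a , b) , (a , b))) (Fin.<-irrefl refl ∘ P⇒<)
        | ind-no (P? ((c , d) , (c , d))) (Fin.<-irrefl refl ∘ P⇒<)
        | ind-no (P? ((c , d) , (a , b))) (ℕ.<-asym a<c ∘ P⇒<)
  = ℕ.+-identityʳ _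

crosses-block : ∀ (a b c d : Fin N) → a < c → c < b →
  PairCount.block (ind ∘ crosses?) (a , b) (c , d) ≡ ind (b Fin.<? d)
crosses-block a b c d a<c c<b = trans (irrefl-block crosses? a b c d proj₁ a<c)
  (ind-cong (crosses? ((a , b) , (c , d))) (b Fin.<? d) (proj₂ ∘ proj₂) (λ b<d → a<c , c<b , b<d))

nests-block : ∀ (a b c d : Fin N) → a < c → c < d →
  PairCount.block (ind ∘ nests?) (a , b) (c , d) ≡ ind (d Fin.<? b)
nests-block a b c d a<c c<d = trans (irrefl-block nests? a b c d proj₁ a<c)
  (ind-cong (nests? ((a , b) , (c , d))) (d Fin.<? b) (proj₂ ∘ proj₂) (λ d<b → a<c , c<d , d<b))

cross-total : (m : Vec (Pair N) k) → cross m ≡ PairCount.total (ind ∘ crosses?) (toList m)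
cross-total m = length-filter-ind crosses? (cartesianProduct (toList m) (toList m))

nest-total : (m : Vec (Pair N) k) → nest m ≡ PairCount.total (ind ∘ nests?) (toList m)
nest-total m = length-filter-ind nests? (cartesianProduct (toList m) (toList m))

CrossGain : Vec (Pair N) k → Vec (Pair N) k → Set
CrossGain m m′ = cross m′ ≡ suc (cross m) × cross m′ ℕ.+ nest m′ ≡ cross m ℕ.+ nest m

module _ {m m′ : Vec (Pair N) k} (e : Exchange m m′) where
  open Exchange e
  private
    module Cr = PairCount (ind ∘ crosses? {N})
    module Ne = PairCount (ind ∘ nests? {N})

  -- Let r = (e , f). As e is not between a and c, the conditions a < e and c < e are equivalent, so
  -- only the right endpoint of the first arc matters.
  crosses-outgoing : ∀ r → proj₁ r < a ⊎ c < proj₁ r →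
                     Cr.outgoing (a , b) (c , d) r ≡ Cr.outgoing (a , d) (c , b) r
  crosses-outgoing r side = ind-+-crossed
    (crosses? ((a , b) , r)) (crosses? ((a , d) , r)) (crosses? ((c , d) , r)) (crosses? ((c , b) , r))
    ((λ (a<e , e<b , b<f) → to a<e , e<b , b<f) , (λ (c<e , e<b , b<f) → ℕ.<-trans a<c c<e , e<b , b<f))
    ((λ (c<e , e<d , d<f) → ℕ.<-trans a<c c<e , e<d , d<f) , (λ (a<e , e<d , d<f) → to a<e , e<d , d<f))
    where
    to : a < proj₁ r → c < proj₁ r
    to a<e = [ (λ e<a → contradiction a<e (ℕ.<-asym e<a)) , (λ c<e → c<e) ]′ side

  -- Let r = (e , f). If c < e, no crossing occurs. If e < a and c < f, only f < b or f < d is left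
  -- to decide, so the relation follows the right endpoint. If e < a and f ≤ c, arcs from c are not
  -- crossed and f is below both b and d, so it follows the left endpoint.
  crosses-incoming : ∀ r → proj₁ r < a ⊎ c < proj₁ r →
                     Cr.incoming (a , b) (c , d) r ≡ Cr.incoming (a , d) (c , b) r
  crosses-incoming r (inj₂ c<e) = ind-+-straight
    (crosses? (r , (a , b))) (crosses? (r , (a , d))) (crosses? (r , (c , d))) (crosses? (r , (c , b)))
    ( (λ (e<a , _) → contradiction e<a (ℕ.<-asym (ℕ.<-trans a<c c<e)))
    , (λ (e<a , _) → contradiction e<a (ℕ.<-asym (ℕ.<-trans a<c c<e))))
    ((λ (e<c , _) → contradiction e<c (ℕ.<-asym c<e)) , (λ (e<c , _) → contradiction e<c (ℕ.<-asym c<e)))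
  crosses-incoming r (inj₁ e<a) with c Fin.<? proj₂ r
  ... | yes c<f = ind-+-crossed
    (crosses? (r , (a , b))) (crosses? (r , (a , d))) (crosses? (r , (c , d))) (crosses? (r , (c , b)))
    ( (λ (e<a , _ , f<b) → ℕ.<-trans e<a a<c , c<f , f<b) , (λ (_ , _ , f<b) → e<a , ℕ.<-trans a<c c<f , f<b))
    ( (λ (_ , _ , f<d) → e<a , ℕ.<-trans a<c c<f , f<d) , (λ (_ , _ , f<d) → ℕ.<-trans e<a a<c , c<f , f<d))
  ... | no c≮f = ind-+-straight
    (crosses? (r , (a , b))) (crosses? (r , (a , d))) (crosses? (r , (c , d))) (crosses? (r , (c , b)))
    ( (λ (e<a , a<f , _) → e<a , a<f , ℕ.≤-<-trans (ℕ.≮⇒≥ c≮f) c<d)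
    , (λ (e<a , a<f , _) → e<a , a<f , ℕ.≤-<-trans (ℕ.≮⇒≥ c≮f) c<b))
    ((λ (_ , c<f , _) → contradiction c<f c≮f) , (λ (_ , c<f , _) → contradiction c<f c≮f))

  nests-outgoing : ∀ r → proj₁ r < a ⊎ c < proj₁ r →
                   Ne.outgoing (a , b) (c , d) r ≡ Ne.outgoing (a , d) (c , b) r
  nests-outgoing r side = ind-+-crossed
    (nests? ((a , b) , r)) (nests? ((a , d) , r)) (nests? ((c , d) , r)) (nests? ((c , b) , r))
    ((λ (a<e , e<f , f<b) → to a<e , e<f , f<b) , (λ (c<e , e<f , f<b) → ℕ.<-trans a<c c<e , e<f , f<b))
    ((λ (c<e , e<f , f<d) → ℕ.<-trans a<c c<e , e<f , f<d) , (λ (a<e , e<f , f<d) → to a<e , e<f , f<d))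
    where
    to : a < proj₁ r → c < proj₁ r
    to a<e = [ (λ e<a → contradiction a<e (ℕ.<-asym e<a)) , (λ c<e → c<e) ]′ side

  -- With r = (e , f), the conditions e < a and e < c are equivalent, which leaves b < f or d < f to
  -- decide.
  nests-incoming : ∀ r → proj₁ r < a ⊎ c < proj₁ r →
                   Ne.incoming (a , b) (c , d) r ≡ Ne.incoming (a , d) (c , b) r
  nests-incoming r side = ind-+-crossed
    (nests? (r , (a , b))) (nests? (r , (a , d))) (nests? (r , (c , d))) (nests? (r , (c , b)))
    ((λ (e<a , a<b , b<f) → ℕ.<-trans e<a a<c , c<b , b<f) , (λ (e<c , _ , b<f) → to e<c , ℕ.<-trans a<c c<b , b<f))
    ((λ (e<c , _ , d<f) → to e<c , ℕ.<-trans a<c c<d , d<f) , (λ (e<a , _ , d<f) → ℕ.<-trans e<a a<c , c<d , d<f))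
    where
    to : proj₁ r < c → proj₁ r < a
    to e<c = [ (λ e<a → e<a) , (λ c<e → contradiction e<c (ℕ.<-asym c<e)) ]′ side

  -- Here `u` and `v` count the pairs involving a third arc. The two arcs cross before and nest
  -- after if b < d, and the other way round if d < b.
  exchange-counts : ∃₂ λ u v →
    (cross m ≡ ind (b Fin.<? d) ℕ.+ u × cross m′ ≡ ind (d Fin.<? b) ℕ.+ u) ×
    (nest m ≡ ind (d Fin.<? b) ℕ.+ v × nest m′ ≡ ind (b Fin.<? d) ℕ.+ v)
  exchange-counts
    with u , cr , cr′ ← Cr.total-exchange source target
           (All.map (λ {r} → crosses-outgoing r) outside) (All.map (λ {r} → crosses-incoming r) outside)
       | v , ne , ne′ ← Ne.total-exchange source target
           (All.map (λ {r} → nests-outgoing r) outside) (All.map (λ {r} → nests-incoming r) outside)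
    = u , v
    , ( trans (cross-total m) (trans cr (cong (ℕ._+ u) (crosses-block a b c d a<c c<b)))
      , trans (cross-total m′) (trans cr′ (cong (ℕ._+ u) (crosses-block a d c b a<c c<d))))
    , ( trans (nest-total m) (trans ne (cong (ℕ._+ v) (nests-block a b c d a<c c<d)))
      , trans (nest-total m′) (trans ne′ (cong (ℕ._+ v) (nests-block a d c b a<c c<b))))

  exchange-gain : d < b → CrossGain m m′
  exchange-gain d<b with u , v , (cr , cr′) , (ne , ne′) ← exchange-counts =
    trans crosses′ (cong suc (sym crosses)) ,
    trans (cong₂ ℕ._+_ crosses′ nests′) (trans (sym (ℕ.+-suc u v)) (sym (cong₂ ℕ._+_ crosses nests)))
    where
    db = ind-yes (d Fin.<? b) d<b
    bd = ind-no (b Fin.<? d) (ℕ.<-asym d<b)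
    crosses  = trans cr (cong (ℕ._+ u) bd)
    crosses′ = trans cr′ (cong (ℕ._+ u) db)
    nests    = trans ne (cong (ℕ._+ v) db)
    nests′   = trans ne′ (cong (ℕ._+ v) bd)

-- The case b < d is the case d < b of the reversed exchange.
Flip-cross : IsMatching m → Flip m m′ → CrossGain m m′ ⊎ CrossGain m′ m
Flip-cross im f with Flip⇒Exchange im f
... | e with Fin.<-cmp (Exchange.b e) (Exchange.d e)
...   | tri< b<d _ _ = inj₂ (exchange-gain (Exchange-sym e) b<d)
...   | tri≈ _ b≡d _ = contradiction b≡d (Exchange.b≢d e)
...   | tri> _ _ d<b = inj₁ (exchange-gain e d<b)

-- The matching (1 , 2), (3 , 4), ....

position : ∀ {n} → Fin n → Fin 2 → Fin (2 ℕ.* n)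
position {n} i e = cast (ℕ.*-comm n 2) (combine i e)

toℕ-position : ∀ {n} (i : Fin n) e → toℕ (position i e) ≡ 2 ℕ.* toℕ i ℕ.+ toℕ e
toℕ-position i e = trans (Fin.toℕ-cast _ (combine i e)) (Fin.toℕ-combine i e)

position-injective : ∀ {n} (i j : Fin n) e f → position i e ≡ position j f → i ≡ j
position-injective {n} i j e f eq = Fin.combine-injectiveˡ i e j f (Fin.toℕ-injective
  (trans (sym (Fin.toℕ-cast _ (combine i e))) (trans (cong toℕ eq) (Fin.toℕ-cast _ (combine j f)))))

position-surjective : ∀ {n} (v : Fin (2 ℕ.* n)) → ∃₂ λ i e → v ≡ position i e
position-surjective {n} v with i , e , eq ← Fin.combine-surjective {n} {2} (cast (ℕ.*-comm 2 n) v) =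
  i , e , trans (sym (Fin.cast-involutive (ℕ.*-comm n 2) (ℕ.*-comm 2 n) v)) (cong (cast _) (sym eq))

arc : ∀ {n} → Fin n → Pair (2 ℕ.* n)
arc i = position i zero , position i (suc zero)

∈arc⇒position : ∀ {n v} (i : Fin n) → v ∈ₚ arc i → ∃ λ e → v ≡ position i e
∈arc⇒position i (inj₁ eq) = zero , eq
∈arc⇒position i (inj₂ eq) = suc zero , eq

position∈arc : ∀ {n} (i : Fin n) e → position i e ∈ₚ arc i
position∈arc i zero       = inj₁ refl
position∈arc i (suc zero) = inj₂ refl

canonical : ∀ n → Vec (Pair (2 ℕ.* n)) n
canonical n = tabulate arc

lookup-canonical : ∀ {n} (i : Fin n) → lookup (canonical n) i ≡ arc i
lookup-canonical = lookup∘tabulate arc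

canonical-perfect : ∀ n → IsPerfectMatching (canonical n)
canonical-perfect n = record
  { covers   = λ v → let i , e , v≡ = position-surjective {n} v in
      i , subst₂ _∈ₚ_ (sym v≡) (sym (lookup-canonical i)) (position∈arc i e)
  ; disjoint = λ v i j v∈i v∈j →
      let e , v≡i = ∈arc⇒position i (subst (v ∈ₚ_) (lookup-canonical i) v∈i)
          f , v≡j = ∈arc⇒position j (subst (v ∈ₚ_) (lookup-canonical j) v∈j)
      in position-injective i j e f (trans (sym v≡i) v≡j)
  ; oriented = λ i → subst (λ p → proj₁ p < proj₂ p) (sym (lookup-canonical i))
      (subst₂ ℕ._<_ (sym (toℕ-position i zero)) (sym (toℕ-position i (suc zero)))
        (ℕ.+-monoʳ-< (2 ℕ.* toℕ i) (ℕ.s≤s ℕ.z≤n)))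
  ; sorted   = λ i j i<j → subst₂ (λ p q → proj₁ p < proj₁ q) (sym (lookup-canonical i)) (sym (lookup-canonical j))
      (subst₂ ℕ._<_ (sym (toℕ-position i zero)) (sym (toℕ-position j zero))
        (ℕ.+-monoˡ-< 0 (ℕ.*-monoʳ-< 2 i<j)))
  }

-- The endpoints of an arc are consecutive, so nothing lies strictly between them.
arcs-non-overlapping : ∀ {n} (i j : Fin n) → proj₁ (arc i) < proj₁ (arc j) → ¬ proj₁ (arc j) < proj₂ (arc i)
arcs-non-overlapping i j aᵢ<aⱼ aⱼ<bᵢ = ℕ.<⇒≱ aᵢ<aⱼ (ℕ.s≤s⁻¹ (subst (toℕ (position j zero) ℕ.<_) bᵢ≡1+aᵢ aⱼ<bᵢ))
  where
  bᵢ≡1+aᵢ : toℕ (position i (suc zero)) ≡ suc (toℕ (position i zero))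
  bᵢ≡1+aᵢ = trans (toℕ-position i (suc zero))
              (trans (ℕ.+-suc (2 ℕ.* toℕ i) 0) (cong suc (sym (toℕ-position i zero))))

canonical-non-overlapping : ∀ {n} {p q} → p ∈ toList (canonical n) → q ∈ toList (canonical n) →
                            proj₁ p < proj₁ q → ¬ proj₁ q < proj₂ p
canonical-non-overlapping p∈ q∈
  with i , refl ← tabulate⁻ (Vec.∈-toList⁻ p∈) | j , refl ← tabulate⁻ (Vec.∈-toList⁻ q∈) =
  arcs-non-overlapping i j

cross-canonical : ∀ n → cross (canonical n) ≡ 0
cross-canonical n = cong length (filter-none crosses? (All.tabulate λ {pq} pq∈ (a<c , c<b , _) →
  let p∈ , q∈ = ∈-cartesianProduct⁻ (toList (canonical n)) (toList (canonical n)) {pq} pq∈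
  in canonical-non-overlapping {n} p∈ q∈ a<c c<b))

nest-canonical : ∀ n → nest (canonical n) ≡ 0
nest-canonical n = cong length (filter-none nests? (All.tabulate λ {pq} pq∈ (a<c , c<d , d<b) →
  let p∈ , q∈ = ∈-cartesianProduct⁻ (toList (canonical n)) (toList (canonical n)) {pq} pq∈
  in canonical-non-overlapping {n} p∈ q∈ a<c (ℕ.<-trans c<d d<b)))

-- Obtained from `classify` rather than by recursion along `tabulate`: an exchange would exhibit two
-- overlapping arcs.
canonical-Chain : ∀ n → Chain 0 (canonical n)
canonical-Chain n with classify (perfect⇒matching (canonical-perfect n))
... | inj₁ ch      = ch
... | inj₂ (m′ , f) = ⊥-elim (canonical-non-overlapping {n} (∈-resp-↭ (↭-sym source) (here refl))
                        (∈-resp-↭ (↭-sym source) (there (here refl))) a<c c<b)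
  where open Exchange (Flip⇒Exchange (perfect⇒matching (canonical-perfect n)) f)

-- The flip as an involution on perfect matchings.

module _ {n} {m : Vec (Pair (2 ℕ.* n)) n} (pm : IsPerfectMatching m) where

  -- A chain of n arcs on 2n points starting from bound 0 is tight, so it must be `canonical n`.
  canonical-or-Flip : m ≡ canonical n ⊎ Flip m (flip m)
  canonical-or-Flip with classify (perfect⇒matching pm)
  ... | inj₁ ch      = inj₁ (Chain-unique refl ch (canonical-Chain n))
  ... | inj₂ (m′ , f) = inj₂ (subst (Flip m) (sym (Flip⇒flip f)) f)

  flip-perfect : IsPerfectMatching (flip m)
  flip-perfect with canonical-or-Flip
  ... | inj₁ refl = subst IsPerfectMatching (sym (Chain⇒flip (canonical-Chain n))) pm
  ... | inj₂ f    = Flip-perfect f pm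

  flip-involutive : flip (flip m) ≡ m
  flip-involutive with canonical-or-Flip
  ... | inj₁ refl = trans (cong flip fixed) fixed
    where fixed = Chain⇒flip (canonical-Chain n)
  ... | inj₂ f    = Flip⇒flip (Flip-sym f)

  -- A proper exchange changes `cross` by exactly one. Comparing `cross m` with `cross (flip m)`
  -- thus detects the fixed point and orients every other orbit.
  cross-flip-fixed : cross m ≡ cross (flip m) → m ≡ canonical n
  cross-flip-fixed eq with canonical-or-Flip
  ... | inj₁ m≡ = m≡
  ... | inj₂ f with Flip-cross (perfect⇒matching pm) f
  ...   | inj₁ (gain , _) = contradiction (trans (sym gain) (sym eq)) ℕ.1+n≢n
  ...   | inj₂ (gain , _) = contradiction (trans (sym gain) eq) ℕ.1+n≢n

  cross-flip-increasing : cross m ℕ.< cross (flip m) → Flip m (flip m) × CrossGain m (flip m)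
  cross-flip-increasing lt with canonical-or-Flip
  ... | inj₁ refl = contradiction (sym (cong cross (Chain⇒flip (canonical-Chain n)))) (ℕ.<⇒≢ lt)
  ... | inj₂ f with Flip-cross (perfect⇒matching pm) f
  ...   | inj₁ gain       = f , gain
  ...   | inj₂ (gain , _) = contradiction (subst (cross (flip m) ℕ.<_) (sym gain) (ℕ.n<1+n _)) (ℕ.<-asym lt)

-- The list of perfect matchings as a set.

vectors-unique : {xs : List A} → Unique xs → ∀ n → Unique (vectors xs n)
vectors-unique xs! zero    = [] ∷ []
vectors-unique xs! (suc n) = Unique.cartesianProductWith⁺ _∷_ ∷-injective xs! (vectors-unique xs! n)

∈-vectors : {xs : List A} → (∀ x → x ∈ xs) → ∀ {n} (v : Vec A n) → v ∈ vectors xs n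
∈-vectors ∈xs []      = here refl
∈-vectors ∈xs (x ∷ v) = ∈-cartesianProductWith⁺ _∷_ (∈xs x) (∈-vectors ∈xs v)

perfectMatchings-unique : ∀ n → Unique (perfectMatchings n)
perfectMatchings-unique n = Unique.filter⁺ isPerfectMatching?
  (vectors-unique (Unique.cartesianProduct⁺ (Unique.allFin⁺ (2 ℕ.* n)) (Unique.allFin⁺ (2 ℕ.* n))) n)

∈-perfectMatchings⁺ : ∀ {n} {m : Vec (Pair (2 ℕ.* n)) n} → IsPerfectMatching m → m ∈ perfectMatchings n
∈-perfectMatchings⁺ {n} {m} = ∈-filter⁺ isPerfectMatching?
  (∈-vectors (λ (a , b) → ∈-cartesianProduct⁺ (∈-allFin a) (∈-allFin b)) m)

∈-perfectMatchings⁻ : ∀ {n} {m : Vec (Pair (2 ℕ.* n)) n} → m ∈ perfectMatchings n → IsPerfectMatching m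
∈-perfectMatchings⁻ {n} m∈ = proj₂ (∈-filter⁻ isPerfectMatching?
  {xs = vectors (cartesianProduct (allFin (2 ℕ.* n)) (allFin (2 ℕ.* n))) n} m∈)

-- A left inverse on the members of `xs` suffices; `flip` is only controlled on perfect matchings.
unique-map : {φ ψ : A → A} {xs : List A} → (∀ {x} → x ∈ xs → ψ (φ x) ≡ x) → Unique xs → Unique (map φ xs)
unique-map ψφ []          = []
unique-map {ψ = ψ} ψφ (x∉ ∷ xs!) =
  All.map⁺ (All.tabulate λ y∈ φx≡φy →
    All.lookup x∉ y∈ (trans (sym (ψφ (here refl))) (trans (cong ψ φx≡φy) (ψφ (there y∈))))) ∷
  unique-map {ψ = ψ} (ψφ ∘ there) xs!

same-elements⇒↭ : {xs ys : List A} → Unique xs → Unique ys →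
                  (∀ {z} → z ∈ xs → z ∈ ys) → (∀ {z} → z ∈ ys → z ∈ xs) → xs ↭ ys
same-elements⇒↭ xs! ys! f g = ∼bag⇒↭ (unique∧set⇒bag xs! ys! (mk⇔ f g))

fixed↭canonical : ∀ n → filter (λ m → cross m ℕ.≟ cross (flip m)) (perfectMatchings n) ↭ canonical n ∷ []
fixed↭canonical n = same-elements⇒↭ (Unique.filter⁺ fixed? (perfectMatchings-unique n)) ([] ∷ [])
  (λ m∈ → let m∈pm , eq = ∈-filter⁻ fixed? {xs = perfectMatchings n} m∈ in
    here (cross-flip-fixed (∈-perfectMatchings⁻ m∈pm) eq))
  (λ { (here refl) → ∈-filter⁺ fixed? (∈-perfectMatchings⁺ (canonical-perfect n))
         (cong cross (sym (Chain⇒flip (canonical-Chain n)))) })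
  where
  fixed? : (m : Vec (Pair (2 ℕ.* n)) n) → Dec (cross m ≡ cross (flip m))
  fixed? m = cross m ℕ.≟ cross (flip m)

-- Finite sums in the ring and cancellation by an involution.

module _ {c ℓ} (R : CommutativeRing c ℓ) where

  open CommutativeRing R hiding (zero; refl; sym; trans)
  private module ≈ = CommutativeRing R using (refl; sym; trans)
  open RawSemiringDefinitions (Semiring.rawSemiring semiring) using (_^_)
  open import Algebra.Properties.Ring ring using (-1*x≈-x; -0#≈0#; -‿+-comm)
  open import Algebra.Properties.CommutativeSemigroup *-commutativeSemigroup using (x∙yz≈y∙xz; interchange)
  open import Algebra.Properties.CommutativeSemigroup +-commutativeSemigroup
    using () renaming (x∙yz≈y∙xz to x+[y+z]≈y+[x+z]; interchange to +-interchange)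
  open import Relation.Binary.Reasoning.Setoid setoid

  ∑-↭ : ∀ {xs ys : List A} (f : A → Carrier) → xs ↭ ys → ∑ R xs f ≈ ∑ R ys f
  ∑-↭ f xs↭ys = foldr-commMonoid setoid +-isCommutativeMonoid (↭⇒↭ₛ′ isEquivalence (map⁺ f xs↭ys))

  ∑-split : {P : A → Set} (P? : Decidable P) (xs : List A) (f : A → Carrier) →
            ∑ R xs f ≈ ∑ R (filter P? xs) f + ∑ R (filter (¬? ∘ P?) xs) f
  ∑-split P? []       f = ≈.sym (+-identityˡ 0#)
  ∑-split P? (x ∷ xs) f with P? x
  ... | yes _ = ≈.trans (+-congˡ (∑-split P? xs f)) (≈.sym (+-assoc (f x) _ _))
  ... | no  _ = ≈.trans (+-congˡ (∑-split P? xs f)) (x+[y+z]≈y+[x+z] (f x) _ _)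

  ∑-neg : (xs : List A) {f g : A → Carrier} → (∀ {x} → x ∈ xs → g x ≈ - f x) → ∑ R xs g ≈ - ∑ R xs f
  ∑-neg []       g≈-f = ≈.sym -0#≈0#
  ∑-neg (x ∷ xs) g≈-f = ≈.trans (+-cong (g≈-f (here refl)) (∑-neg xs (g≈-f ∘ there))) (-‿+-comm _ _)

  -- The statistic `s` selects a representative of each orbit on which it varies: `φ` exchanges
  -- `ups` and `downs`. Reindexing the whole moved sum S by `φ` would only give S = -S, that is 2S =
  -- 0, which does not imply S = 0 in a general ring.
  module _ {xs : List A} (xs! : Unique xs) (φ : A → A) (s : A → ℕ) (f : A → Carrier)
    (φ-closed     : ∀ {x} → x ∈ xs → φ x ∈ xs)
    (φ-involutive : ∀ {x} → x ∈ xs → φ (φ x) ≡ x)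
    (f-reversed   : ∀ {x} → x ∈ xs → s x ℕ.< s (φ x) → f (φ x) ≈ - f x)
    where

    private
      fixed? : ∀ x → Dec (s x ≡ s (φ x))
      fixed? x = s x ℕ.≟ s (φ x)
      up? : ∀ x → Dec (s x ℕ.< s (φ x))
      up? x = s x ℕ.<? s (φ x)

      moved ups downs : List A
      moved = filter (¬? ∘ fixed?) xs
      ups   = filter up? moved
      downs = filter (¬? ∘ up?) moved

      moved⁻ : ∀ {x} → x ∈ moved → x ∈ xs × s x ≢ s (φ x)
      moved⁻ = ∈-filter⁻ (¬? ∘ fixed?)

      ups⁻ : ∀ {x} → x ∈ ups → x ∈ xs × s x ℕ.< s (φ x)
      ups⁻ x∈ = let x∈moved , lt = ∈-filter⁻ up? {xs = moved} x∈ in proj₁ (moved⁻ x∈moved) , lt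

      downs⁻ : ∀ {x} → x ∈ downs → x ∈ xs × s (φ x) ℕ.< s x
      downs⁻ x∈ with x∈moved , ≮ ← ∈-filter⁻ (¬? ∘ up?) {xs = moved} x∈ with x∈xs , ≢ ← moved⁻ x∈moved =
        x∈xs , ℕ.≤∧≢⇒< (ℕ.≮⇒≥ ≮) (≢ ∘ sym)

      φ-up⇒down : ∀ {x} → x ∈ ups → φ x ∈ downs
      φ-up⇒down {x} x∈ with x∈xs , lt ← ups⁻ x∈ =
        ∈-filter⁺ (¬? ∘ up?) (∈-filter⁺ (¬? ∘ fixed?) (φ-closed x∈xs) (ℕ.>⇒≢ lt′)) (ℕ.<-asym lt′)
        where lt′ = subst (λ z → s z ℕ.< s (φ x)) (sym (φ-involutive x∈xs)) lt

      φ-down⇒up : ∀ {x} → x ∈ downs → φ x ∈ ups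
      φ-down⇒up {x} x∈ with x∈xs , lt ← downs⁻ x∈ =
        ∈-filter⁺ up? (∈-filter⁺ (¬? ∘ fixed?) (φ-closed x∈xs) (ℕ.<⇒≢ lt′)) lt′
        where lt′ = subst (λ z → s (φ x) ℕ.< s z) (sym (φ-involutive x∈xs)) lt

      φ-ups↭downs : map φ ups ↭ downs
      φ-ups↭downs = same-elements⇒↭
        (unique-map {ψ = φ} (φ-involutive ∘ proj₁ ∘ ups⁻) (Unique.filter⁺ up? moved!))
        (Unique.filter⁺ (¬? ∘ up?) moved!)
        (λ z∈ → let x , x∈ , z≡ = ∈-map⁻ φ z∈ in subst (_∈ downs) (sym z≡) (φ-up⇒down x∈))
        (λ z∈ → subst (_∈ map φ ups) (φ-involutive (proj₁ (downs⁻ z∈))) (∈-map⁺ φ (φ-down⇒up z∈)))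
        where moved! = Unique.filter⁺ (¬? ∘ fixed?) xs!

    sign-reversing-involution : ∑ R xs f ≈ ∑ R (filter fixed? xs) f
    sign-reversing-involution = begin
      ∑ R xs f                                           ≈⟨ ∑-split fixed? xs f ⟩
      ∑ R (filter fixed? xs) f + ∑ R moved f             ≈⟨ +-congˡ cancel ⟩
      ∑ R (filter fixed? xs) f + 0#                      ≈⟨ +-identityʳ _ ⟩
      ∑ R (filter fixed? xs) f                           ∎
      where
      cancel : ∑ R moved f ≈ 0#
      cancel = begin
        ∑ R moved f                    ≈⟨ ∑-split up? moved f ⟩
        -- The descents are listed as the images of the ascents, so the terms cancel in pairs.
        ∑ R ups f + ∑ R downs f        ≈⟨ +-congˡ (∑-↭ f φ-ups↭downs) ⟨
        ∑ R ups f + ∑ R (map φ ups) f  ≡⟨ cong (λ zs → ∑ R ups f + List.foldr _+_ 0# zs) (sym (map-∘ ups)) ⟩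
        ∑ R ups f + ∑ R ups (f ∘ φ)    ≈⟨ +-congˡ (∑-neg ups (λ x∈ → let x∈xs , lt = ups⁻ x∈ in f-reversed x∈xs lt)) ⟩
        ∑ R ups f + - ∑ R ups f        ≈⟨ -‿inverseʳ _ ⟩
        0#                             ∎

  ∏-cong : ∀ n {f g : Fin n → Carrier} → (∀ i → f i ≈ g i) → ∏ R n f ≈ ∏ R n g
  ∏-cong zero    f≈g = ≈.refl
  ∏-cong (suc n) f≈g = *-cong (f≈g zero) (∏-cong n (f≈g ∘ suc))

  -- Weights of matchings.

  module _ (ƛ : Carrier) (x y : ℕ → Carrier) where

    arcWeight : Pair N → Carrier
    arcWeight (i , j) = x ⟦ i ⟧ * y ⟦ j ⟧

    arcsWeight : Vec (Pair N) k → Carrier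
    arcsWeight {k = k} m = ∏ R k (arcWeight ∘ lookup m)

    weight : Vec (Pair N) k → Carrier
    weight m = (- 1#) ^ cross m * ƛ ^ (cross m ℕ.+ nest m) * arcsWeight m

    -- This is where the product form of the entries enters: the factors of left and right endpoints
    -- separate and can be regrouped.
    Flip-arcsWeight : Flip m m′ → arcsWeight m′ ≈ arcsWeight m
    Flip-arcsWeight (here {m = m} {a} {b} {c} {d} _ _) = begin
      (xa * yd) * ((xc * yb) * Π)  ≈⟨ *-assoc _ _ _ ⟨
      ((xa * yd) * (xc * yb)) * Π  ≈⟨ *-congʳ (*-congˡ (*-comm xc yb)) ⟩
      ((xa * yd) * (yb * xc)) * Π  ≈⟨ *-congʳ (interchange xa yd yb xc) ⟩
      ((xa * yb) * (yd * xc)) * Π  ≈⟨ *-congʳ (*-congˡ (*-comm yd xc)) ⟩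
      ((xa * yb) * (xc * yd)) * Π  ≈⟨ *-assoc _ _ _ ⟩
      (xa * yb) * ((xc * yd) * Π)  ∎
      where
      xa = x ⟦ a ⟧
      xc = x ⟦ c ⟧
      yb = y ⟦ b ⟧
      yd = y ⟦ d ⟧
      Π  = arcsWeight m
    Flip-arcsWeight (there _ f) = *-congˡ (Flip-arcsWeight f)

    -- The additional crossing gives one more factor `- 1#`, while the exponent of `ƛ` and the
    -- product over the arcs are unchanged.
    CrossGain-weight : Flip m m′ → CrossGain m m′ → weight m′ ≈ - weight m
    CrossGain-weight {m = m} {m′ = m′} f (gain , same) = begin
      (- 1#) ^ cross m′ * ƛ ^ (cross m′ ℕ.+ nest m′) * arcsWeight m′
        ≈⟨ *-cong (*-cong (reflexive (cong ((- 1#) ^_) gain)) (reflexive (cong (ƛ ^_) same))) (Flip-arcsWeight f) ⟩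
      (- 1# * (- 1#) ^ cross m) * ƛ ^ (cross m ℕ.+ nest m) * arcsWeight m
        ≈⟨ *-congʳ (*-assoc _ _ _) ⟩
      - 1# * ((- 1#) ^ cross m * ƛ ^ (cross m ℕ.+ nest m)) * arcsWeight m
        ≈⟨ *-assoc _ _ _ ⟩
      - 1# * weight m
        ≈⟨ -1*x≈-x _ ⟩
      - weight m
        ∎

    weight-canonical : ∀ n → weight (canonical n) ≈ ∏ R n (λ i → x (2 ℕ.* ⟦ i ⟧ ℕ.∸ 1) * y (2 ℕ.* ⟦ i ⟧))
    weight-canonical n = begin
      (- 1#) ^ cross (canonical n) * ƛ ^ (cross (canonical n) ℕ.+ nest (canonical n)) * arcsWeight (canonical n)
        ≡⟨ cong₂ (λ h k → (- 1#) ^ h * ƛ ^ (h ℕ.+ k) * arcsWeight (canonical n)) (cross-canonical n) (nest-canonical n) ⟩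
      1# * 1# * arcsWeight (canonical n)
        ≈⟨ ≈.trans (*-congʳ (*-identityˡ 1#)) (*-identityˡ _) ⟩
      arcsWeight (canonical n)
        ≈⟨ ∏-cong n (λ i → reflexive (trans (cong arcWeight (lookup-canonical i)) (cong₂ (λ h k → x h * y k) (left i) (right i)))) ⟩
      ∏ R n (λ i → x (2 ℕ.* ⟦ i ⟧ ℕ.∸ 1) * y (2 ℕ.* ⟦ i ⟧))
        ∎
      where
      right : (i : Fin n) → ⟦ position i (suc zero) ⟧ ≡ 2 ℕ.* ⟦ i ⟧
      right i = trans (cong suc (toℕ-position i (suc zero))) (arith (toℕ i))
        where
        arith : ∀ t → suc (2 ℕ.* t ℕ.+ 1) ≡ 2 ℕ.* suc t
        arith = solve-∀
      -- The double successor makes the truncated subtraction compute: 2t + 2 minus 1 is 2t + 1,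
      -- where t is the zero-based index.
      left : (i : Fin n) → ⟦ position i zero ⟧ ≡ 2 ℕ.* ⟦ i ⟧ ℕ.∸ 1
      left i = trans (cong suc (toℕ-position i zero)) (cong (ℕ._∸ 1) (arith (toℕ i)))
        where
        arith : ∀ t → suc (suc (2 ℕ.* t ℕ.+ 0)) ≡ 2 ℕ.* suc t
        arith = solve-∀

proposition5 : ∀ {c ℓ} (R : CommutativeRing c ℓ) → let open CommutativeRing R in
    (ƛ : Carrier) (x y : ℕ → Carrier) (n : ℕ) .{{_ : NonZero n}} →
    Pf R n ƛ (λ i j → x ⟦ i ⟧ * y ⟦ j ⟧)
    ≈ ∏ R n (λ i → x (2 ℕ.* ⟦ i ⟧ ℕ.∸ 1) * y (2 ℕ.* ⟦ i ⟧))
proposition5 R ƛ x y n = begin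
  ∑ R (perfectMatchings n) w
    -- The statistic is `cross`, which rises by one on the ascending half of each orbit.
    ≈⟨ sign-reversing-involution R (perfectMatchings-unique n) flip cross w
         (∈-perfectMatchings⁺ ∘ flip-perfect ∘ ∈-perfectMatchings⁻)
         (flip-involutive ∘ ∈-perfectMatchings⁻)
         (λ m∈ lt → let f , gain = cross-flip-increasing (∈-perfectMatchings⁻ m∈) lt
                    in CrossGain-weight R ƛ x y f gain) ⟩
  ∑ R (filter (λ m → cross m ℕ.≟ cross (flip m)) (perfectMatchings n)) w
    ≈⟨ ∑-↭ R w (fixed↭canonical n) ⟩
  w (canonical n) + 0#
    ≈⟨ +-identityʳ _ ⟩
  w (canonical n)
    ≈⟨ weight-canonical R ƛ x y n ⟩
  ∏ R n (λ i → x (2 ℕ.* ⟦ i ⟧ ℕ.∸ 1) * y (2 ℕ.* ⟦ i ⟧))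
    ∎
  where
  open CommutativeRing R using (Carrier; _+_; _*_; 0#; +-identityʳ; setoid)
  open import Relation.Binary.Reasoning.Setoid setoid
  w : Vec (Pair (2 ℕ.* n)) n → Carrier
  w = weight R ƛ x y
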